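{- Let $\mathcal{A}=\{A_1,\dots,A_r\}\subset\mathbb{R}^{n\times n}$ be a collection of positive semidefinite matrices and let $\varepsilon\in[0,1)$. Then there exists a subset $T\subseteq[r]$ of size $N^*_\varepsilon(\mathcal{A})-1$ that does not admit any non-trivial $\varepsilon$-sparsifier. In particular, there exists a subset $T\subseteq[r]$ of size $\lim_{\alpha\to0^+}N(\alpha;\mathcal{A})-1$ which does not admit a non-trivial $\varepsilon$-sparsifier for any $\varepsilon\in[0,1)$.
   Context: Collections are regarded as families indexed by $[r]=\{1,\dots,r\}$. $A\preceq B$ means $B-A$ is positive semidefinite (PSD). Connectivity parameter: for $\alpha\ge0$, $N(\alpha;\mathcal{A})$ is the smallest integer such that for every $T\subseteq[r]$ with $|T|\ge N(\alpha;\mathcal{A})$ there exists $i\in T$ with $\alpha A_i\preceq\sum_{j\in T\setminus\{i\}}A_j$; if no such integer (at most $r$) exists, $N(\alpha;\mathcal{A})=r+1$. Connectivity threshold: for $\varepsilon\in[0,1)$ let $\alpha_\varepsilon\in[0,1]$ be the unique real number with $\alpha_\varepsilon(1+\alpha_\varepsilon)=\frac{1-\varepsilon}{1+\varepsilon}$, and $N^*_\varepsilon(\mathcal{A})=N(\alpha_\varepsilon;\mathcal{A})$. A non-trivial $\varepsilon$-sparsifier of $T\subseteq[r]$ is a map $\mu:T\to\mathbb{R}_{\ge0}$ with $|\operatorname{supp}(\mu)|<|T|$ and $(1-\varepsilon)\sum_{i\in T}A_i\preceq\sum_{i\in T}\mu_iA_i\preceq(1+\varepsilon)\sum_{i\in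 T}A_i$, where $\operatorname{supp}(\mu)=\{i\in T:\mu_i\ne0\}$. -}

module Defs where

open import Algebra.Bundles using (CommutativeRing; CommutativeSemiring)
open import Algebra.Structures using (IsCommutativeRing)
open import Axiom.ExcludedMiddle using (ExcludedMiddle)
open import Data.Bool.Base using (if_then_else_)
open import Data.Fin.Base using (Fin)
open import Data.Fin.Subset using (Subset; ∣_∣; _∈_) renaming (_-_ to _∖_)
open import Data.Fin.Subset.Properties using (_∈?_)
open import Data.Nat.Base as ℕ using (ℕ; zero; suc)
open import Data.Product using (∃; ∃!; _×_; _,_; proj₁; proj₂)
open import Data.Sum.Base using (inj₁; inj₂)
open import Data.Vec.Base using (tabulate)
open import Data.Vec.Functional using (Vector)
open import Function.Base using (_∘_)
open import Level using (0ℓ)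
open import Relation.Binary.Bundles using (Poset)
open import Relation.Binary.Core using (Rel)
open import Relation.Binary.Structures using (IsTotalOrder)
open import Relation.Nullary using (¬_; Dec; yes; no; does; contradiction)
open import Relation.Nullary.Decidable using (_×-dec_; ¬?)
import Algebra.Definitions.RawMonoid as RawMonoidDefs
import Algebra.Properties.Ring as RingProperties
import Algebra.Properties.CommutativeMonoid.Sum as Summation
import Algebra.Solver.Ring.NaturalCoefficients.Default as SemiringSolver
import Relation.Binary.Construct.NonStrictToStrict as ToStrict
import Relation.Binary.Reasoning.PartialOrder as PosetReasoning

-- The library has no real numbers, so they are given by their usual axioms:
-- a Dedekind-complete ordered field, which is unique up to isomorphism.
-- Elements are compared by the setoid equality _≈_.

record RealNumbers : Set₁ where
  infix  4 _≈_ _≤_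
  infix  8 -_
  infix  9 _⁻¹
  infixl 7 _*_
  infixl 6 _+_
  field
    Carrier           : Set
    _≈_ _≤_           : Rel Carrier 0ℓ
    _+_ _*_           : Carrier → Carrier → Carrier
    -_                : Carrier → Carrier
    0# 1#             : Carrier
    _⁻¹               : Carrier → Carrier     -- value at 0# is unspecified
    isCommutativeRing : IsCommutativeRing _≈_ _+_ _*_ -_ 0# 1#
    isTotalOrder      : IsTotalOrder _≈_ _≤_
    0≉1               : ¬ 0# ≈ 1#
    *-inverseʳ        : ∀ x → ¬ x ≈ 0# → x * x ⁻¹ ≈ 1#
    +-monoˡ-≤         : ∀ z {x y} → x ≤ y → x + z ≤ y + z
    *-nonNegative     : ∀ {x y} → 0# ≤ x → 0# ≤ y → 0# ≤ x * y

  UpperBound : (Carrier → Set) → Carrier → Set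
  UpperBound P b = ∀ x → P x → x ≤ b

  field
    complete : (P : Carrier → Set) → ∃ P → ∃ (UpperBound P) →
               ∃ λ s → UpperBound P s × (∀ b → UpperBound P b → s ≤ b)

  commutativeRing : CommutativeRing 0ℓ 0ℓ
  commutativeRing = record { isCommutativeRing = isCommutativeRing }

  open CommutativeRing commutativeRing public
    using (_-_; ring; commutativeSemiring; +-commutativeMonoid; +-rawMonoid)

  open ToStrict _≈_ _≤_ public using (_<_)

  infixl 7 _÷_
  _÷_ : Carrier → Carrier → Carrier
  x ÷ y = x * y ⁻¹

  fromℕ : ℕ → Carrier
  fromℕ m = RawMonoidDefs._×_ +-rawMonoid m 1#

  -- lim_{α → 0⁺} g α = l
  RightLimitAt0 : (Carrier → Carrier) → Carrier → Set
  RightLimitAt0 g l =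
    ∀ η → 0# < η → ∃ λ δ → 0# < δ ×
      (∀ α → 0# < α → α < δ → l - η < g α × g α < l + η)

-- Existence and uniqueness of the root of a (1 + a) = q in [0, 1], for
-- 0 ≤ q ≤ 1.  The root is the supremum of { a ≥ 0 | a (1 + a) ≤ q }.

module QuadraticRoot (ℝ : RealNumbers) where

  open RealNumbers ℝ

  open CommutativeRing commutativeRing
    using (refl; sym; trans; +-congˡ; +-congʳ; *-congˡ; *-congʳ;
           +-comm; +-assoc; *-comm; *-assoc; +-identityˡ; +-identityʳ;
           *-identityˡ; *-identityʳ; -‿inverseˡ; -‿inverseʳ; zeroˡ; zeroʳ;
           distribˡ; distribʳ)
  open RingProperties ring using (-‿distribʳ-*)
  module O = IsTotalOrder isTotalOrder

  poset : Poset 0ℓ 0ℓ 0ℓ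
  poset = record { isPartialOrder = O.isPartialOrder }

  open PosetReasoning poset
  open SemiringSolver commutativeSemiring using (solve; con; _:+_; _:*_; _:=_)

  +-monoʳ-≤ : ∀ z {x y} → x ≤ y → z + x ≤ z + y
  +-monoʳ-≤ z {x} {y} x≤y = begin
    z + x ≈⟨ +-comm z x ⟩
    x + z ≤⟨ +-monoˡ-≤ z x≤y ⟩
    y + z ≈⟨ +-comm y z ⟩
    z + y ∎

  +-mono-≤ : ∀ {x y u v} → x ≤ y → u ≤ v → x + u ≤ y + v
  +-mono-≤ x≤y u≤v = O.trans (+-monoˡ-≤ _ x≤y) (+-monoʳ-≤ _ u≤v)

  +-nonNeg : ∀ {x y} → 0# ≤ x → 0# ≤ y → 0# ≤ x + y
  +-nonNeg {x} {y} 0≤x 0≤y = begin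
    0#      ≈⟨ +-identityˡ 0# ⟨
    0# + 0# ≤⟨ +-mono-≤ 0≤x 0≤y ⟩
    x + y   ∎

  x≤x+y : ∀ {x y} → 0# ≤ y → x ≤ x + y
  x≤x+y {x} {y} 0≤y = begin
    x      ≈⟨ +-identityʳ x ⟨
    x + 0# ≤⟨ +-monoʳ-≤ x 0≤y ⟩
    x + y  ∎

  y≤x+y : ∀ {x y} → 0# ≤ x → y ≤ x + y
  y≤x+y {x} {y} 0≤x = O.trans (x≤x+y 0≤x) (O.reflexive (+-comm y x))

  x+y-y≈x : ∀ x y → (x + y) - y ≈ x
  x+y-y≈x x y = trans (+-assoc x y (- y))
                 (trans (+-congˡ (-‿inverseʳ y)) (+-identityʳ x))

  x-y+y≈x : ∀ x y → (x - y) + y ≈ x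
  x-y+y≈x x y = trans (+-assoc x (- y) y)
                 (trans (+-congˡ (-‿inverseˡ y)) (+-identityʳ x))

  +-cancelʳ-≤ : ∀ z {x y} → x + z ≤ y + z → x ≤ y
  +-cancelʳ-≤ z {x} {y} p = begin
    x           ≈⟨ x+y-y≈x x z ⟨
    (x + z) - z ≤⟨ +-monoˡ-≤ (- z) p ⟩
    (y + z) - z ≈⟨ x+y-y≈x y z ⟩
    y           ∎

  x+h≤x⇒h≤0 : ∀ {x h} → x + h ≤ x → h ≤ 0#
  x+h≤x⇒h≤0 {x} {h} p = +-cancelʳ-≤ x (begin
    h + x  ≈⟨ +-comm h x ⟩
    x + h  ≤⟨ p ⟩
    x      ≈⟨ +-identityˡ x ⟨
    0# + x ∎)

  x≤y⇒0≤y-x : ∀ {x y} → x ≤ y → 0# ≤ y - x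
  x≤y⇒0≤y-x {x} {y} x≤y = +-cancelʳ-≤ x (begin
    0# + x      ≈⟨ +-identityˡ x ⟩
    x           ≤⟨ x≤y ⟩
    y           ≈⟨ x-y+y≈x y x ⟨
    (y - x) + x ∎)

  split : ∀ {x y} → x ≤ y → ∃ λ d → 0# ≤ d × x + d ≈ y
  split {x} {y} x≤y =
    y - x , x≤y⇒0≤y-x x≤y , trans (+-comm x (y - x)) (x-y+y≈x y x)

  *-monoʳ-≤ : ∀ {z x y} → 0# ≤ z → x ≤ y → z * x ≤ z * y
  *-monoʳ-≤ {z} {x} {y} 0≤z x≤y with split x≤y
  ... | d , 0≤d , x+d≈y = begin
    z * x         ≤⟨ x≤x+y (*-nonNegative 0≤z 0≤d) ⟩
    z * x + z * d ≈⟨ distribˡ z x d ⟨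
    z * (x + d)   ≈⟨ *-congˡ x+d≈y ⟩
    z * y         ∎

  x≤0⇒0≤-x : ∀ {x} → x ≤ 0# → 0# ≤ - x
  x≤0⇒0≤-x {x} x≤0 = +-cancelʳ-≤ x (begin
    0# + x  ≈⟨ +-identityˡ x ⟩
    x       ≤⟨ x≤0 ⟩
    0#      ≈⟨ -‿inverseˡ x ⟨
    - x + x ∎)

  0≤1 : 0# ≤ 1#
  0≤1 with O.total 0# 1#
  ... | inj₁ p = p
  ... | inj₂ 1≤0 = begin
    0#            ≤⟨ *-nonNegative 0≤-1 0≤-1 ⟩
    - 1# * - 1#   ≈⟨ -‿distribʳ-* (- 1#) 1# ⟨
    - (- 1# * 1#) ≈⟨ +-identityʳ _ ⟨
    - (- 1# * 1#) + 0# ≈⟨ +-congˡ (-‿inverseˡ 1#) ⟨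
    - (- 1# * 1#) + (- 1# + 1#) ≈⟨ +-congˡ (+-congʳ (*-identityʳ (- 1#))) ⟨
    - (- 1# * 1#) + (- 1# * 1# + 1#) ≈⟨ +-assoc _ _ _ ⟨
    (- (- 1# * 1#) + - 1# * 1#) + 1# ≈⟨ +-congʳ (-‿inverseˡ _) ⟩
    0# + 1#       ≈⟨ +-identityˡ 1# ⟩
    1#            ∎
    where 0≤-1 = x≤0⇒0≤-x 1≤0

  1≰0 : ¬ 1# ≤ 0#
  1≰0 1≤0 = 0≉1 (O.antisym 0≤1 1≤0)

  1≤x⇒x≉0 : ∀ {x} → 1# ≤ x → ¬ x ≈ 0#
  1≤x⇒x≉0 1≤x x≈0 = 1≰0 (O.trans 1≤x (O.reflexive x≈0))

  ⁻¹-nonNeg : ∀ {x} → 1# ≤ x → 0# ≤ x ⁻¹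
  ⁻¹-nonNeg {x} 1≤x with O.total 0# (x ⁻¹)
  ... | inj₁ p = p
  ... | inj₂ p = contradiction (begin
      1#                     ≈⟨ *-inverseʳ x (1≤x⇒x≉0 1≤x) ⟨
      x * x ⁻¹               ≤⟨ *-monoʳ-≤ (O.trans 0≤1 1≤x) p ⟩
      x * 0#                 ≈⟨ zeroʳ x ⟩
      0#                     ∎) 1≰0

  f : Carrier → Carrier
  f a = a * (1# + a)

  2# 5# 6# : Carrier
  2# = 1# + 1#
  5# = 1# + (1# + 1# + 2#)
  6# = 5# + 1#

  0≤2 : 0# ≤ 2#
  0≤2 = +-nonNeg 0≤1 0≤1

  0≤5 : 0# ≤ 5#
  0≤5 = +-nonNeg 0≤1 (+-nonNeg 0≤2 0≤2)

  f-nonNeg : ∀ {a} → 0# ≤ a → 0# ≤ f a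
  f-nonNeg 0≤a = *-nonNegative 0≤a (+-nonNeg 0≤1 0≤a)

  f-expand : ∀ a h → f (a + h) ≈ f a + h * (1# + (a + a + h))
  f-expand = solve 2 (λ a h → (a :+ h) :* (con 1 :+ (a :+ h))
               := a :* (con 1 :+ a) :+ h :* (con 1 :+ (a :+ a :+ h))) refl

  h≤h*[1+x] : ∀ {h x} → 0# ≤ h → 0# ≤ x → h ≤ h * (1# + x)
  h≤h*[1+x] {h} {x} 0≤h 0≤x = begin
    h             ≤⟨ x≤x+y (*-nonNegative 0≤h 0≤x) ⟩
    h + h * x     ≈⟨ +-congʳ (*-identityʳ h) ⟨
    h * 1# + h * x ≈⟨ distribˡ h 1# x ⟨
    h * (1# + x)  ∎

  f-mono : ∀ {a b} → 0# ≤ a → a ≤ b → f a ≤ f b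
  f-mono {a} {b} 0≤a a≤b with split a≤b
  ... | h , 0≤h , a+h≈b = begin
    f a                          ≤⟨ x≤x+y (*-nonNegative 0≤h
                                     (+-nonNeg 0≤1 (+-nonNeg (+-nonNeg 0≤a 0≤a) 0≤h))) ⟩
    f a + h * (1# + (a + a + h)) ≈⟨ f-expand a h ⟨
    f (a + h)                    ≈⟨ trans (*-congʳ a+h≈b) (*-congˡ (+-congˡ a+h≈b)) ⟩
    f b                          ∎

  f-step : ∀ {a h} → a ≤ 1# → 0# ≤ h → h ≤ 2# → f (a + h) ≤ f a + 5# * h
  f-step {a} {h} a≤1 0≤h h≤2 = begin
    f (a + h)                    ≈⟨ f-expand a h ⟩
    f a + h * (1# + (a + a + h)) ≤⟨ +-monoʳ-≤ (f a) (*-monoʳ-≤ 0≤h (+-monoʳ-≤ 1#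
                                     (+-mono-≤ (+-mono-≤ a≤1 a≤1) h≤2))) ⟩
    f a + h * (1# + (1# + 1# + 2#)) ≈⟨ +-congˡ (*-comm h 5#) ⟩
    f a + 5# * h                 ∎

  6h≈5h+h : ∀ h → 6# * h ≈ 5# * h + h
  6h≈5h+h h = trans (distribʳ h 5# 1#) (+-congˡ (*-identityˡ h))

  1≤6 : 1# ≤ 6#
  1≤6 = y≤x+y 0≤5

  sixth : ∀ {d} → 0# ≤ d → d ≤ 2# →
          ∃ λ h → (0# ≤ h × h ≤ 2#) × d ≈ 5# * h + h
  sixth {d} 0≤d d≤2 = h , (0≤h , h≤2) , d≈
    where
    h : Carrier
    h = d * 6# ⁻¹
    0≤h : 0# ≤ h
    0≤h = *-nonNegative 0≤d (⁻¹-nonNeg 1≤6)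
    d≈ : d ≈ 5# * h + h
    d≈ = begin-equality
      d                 ≈⟨ *-identityʳ d ⟨
      d * 1#            ≈⟨ *-congˡ (*-inverseʳ 6# (1≤x⇒x≉0 1≤6)) ⟨
      d * (6# * 6# ⁻¹)  ≈⟨ *-congˡ (*-comm 6# _) ⟩
      d * (6# ⁻¹ * 6#)  ≈⟨ *-assoc d _ 6# ⟨
      h * 6#            ≈⟨ *-comm h 6# ⟩
      6# * h            ≈⟨ 6h≈5h+h h ⟩
      5# * h + h        ∎
    h≤2 : h ≤ 2#
    h≤2 = begin
      h            ≤⟨ x≤x+y (*-nonNegative 0≤5 0≤h) ⟩
      h + 5# * h   ≈⟨ +-comm h _ ⟩
      5# * h + h   ≈⟨ d≈ ⟨
      d            ≤⟨ d≤2 ⟩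
      2#           ∎

  excess : ∀ {x y d h} → x + d ≈ y → d ≈ 5# * h + h → h ≤ 0# → y ≤ x
  excess {x} {y} {d} {h} x+d≈y d≈5h+h h≤0 = begin
    y                   ≈⟨ x+d≈y ⟨
    x + d               ≈⟨ +-congˡ (trans d≈5h+h (sym (6h≈5h+h h))) ⟩
    x + 6# * h          ≤⟨ +-monoʳ-≤ x (*-monoʳ-≤ (O.trans 0≤1 1≤6) h≤0) ⟩
    x + 6# * 0#         ≈⟨ +-congˡ (zeroʳ 6#) ⟩
    x + 0#              ≈⟨ +-identityʳ x ⟩
    x                   ∎

  regroup : ∀ {x y d h} → x + d ≈ y → d ≈ 5# * h + h → (x + 5# * h) + h ≈ y
  regroup {x} x+d≈y d≈5h+h =
    trans (+-assoc x _ _) (trans (+-congˡ (sym d≈5h+h)) x+d≈y)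

  module Root (q : Carrier) (0≤q : 0# ≤ q) (q≤1 : q ≤ 1#) where

    S : Carrier → Set
    S a = 0# ≤ a × f a ≤ q

    0∈S : S 0#
    0∈S = O.refl , O.trans (O.reflexive (zeroˡ _)) 0≤q

    S≤1 : UpperBound S 1#
    S≤1 a (0≤a , fa≤q) = O.trans (h≤h*[1+x] 0≤a 0≤a) (O.trans fa≤q q≤1)

    1≤2 : 1# ≤ 2#
    1≤2 = x≤x+y 0≤1

    module Supremum (s : Carrier) (ub : UpperBound S s)
                    (least : ∀ b → UpperBound S b → s ≤ b) where

      0≤s : 0# ≤ s
      0≤s = ub 0# 0∈S

      s≤1 : s ≤ 1#
      s≤1 = least 1# S≤1

      fs≤2 : f s ≤ 2#
      fs≤2 = O.trans (f-mono 0≤s s≤1) (O.reflexive (*-identityˡ 2#))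

      below : ∀ {d h} → f s + d ≈ q → 0# ≤ h → h ≤ 2# →
              d ≈ 5# * h + h → h ≤ 0#
      below {d} {h} fs+d≈q 0≤h h≤2 d≈ = x+h≤x⇒h≤0 (ub (s + h)
        (+-nonNeg 0≤s 0≤h , (begin
          f (s + h)            ≤⟨ f-step s≤1 0≤h h≤2 ⟩
          f s + 5# * h         ≤⟨ x≤x+y 0≤h ⟩
          (f s + 5# * h) + h   ≈⟨ regroup fs+d≈q d≈ ⟩
          q                    ∎)))

      q≤fs : q ≤ f s
      q≤fs with O.total q (f s)
      ... | inj₁ p = p
      ... | inj₂ fs≤q =
        let d , 0≤d , fs+d≈q = split fs≤q
            d≤2 = O.trans (y≤x+y (f-nonNeg 0≤s))
                    (O.trans (O.reflexive fs+d≈q) (O.trans q≤1 1≤2))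
            h , (0≤h , h≤2) , d≈ = sixth 0≤d d≤2
        in excess fs+d≈q d≈ (below fs+d≈q 0≤h h≤2 d≈)

      above : ∀ {d h} → q + d ≈ f s → 0# ≤ h → h ≤ 2# →
              d ≈ 5# * h + h → h ≤ 0#
      above {d} {h} q+d≈fs 0≤h h≤2 d≈ = x+h≤x⇒h≤0 (begin
        s + h        ≤⟨ +-monoˡ-≤ h (least (s - h) bound) ⟩
        (s - h) + h  ≈⟨ x-y+y≈x s h ⟩
        s            ∎)
        where
        bound : UpperBound S (s - h)
        bound a a∈S with O.total a (s - h)
        ... | inj₁ p = p
        ... | inj₂ s-h≤a = +-cancelʳ-≤ h (begin
          a + h        ≤⟨ +-monoʳ-≤ a h≤0 ⟩
          a + 0#       ≈⟨ +-identityʳ a ⟩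
          a            ≤⟨ ub a a∈S ⟩
          s            ≈⟨ x-y+y≈x s h ⟨
          (s - h) + h  ∎)
          where
          s≤a+h : s ≤ a + h
          s≤a+h = begin
            s            ≈⟨ x-y+y≈x s h ⟨
            (s - h) + h  ≤⟨ +-monoˡ-≤ h s-h≤a ⟩
            a + h        ∎
          h≤0 : h ≤ 0#
          h≤0 = x+h≤x⇒h≤0 {q + 5# * h} (begin
            (q + 5# * h) + h ≈⟨ regroup q+d≈fs d≈ ⟩
            f s              ≤⟨ f-mono 0≤s s≤a+h ⟩
            f (a + h)        ≤⟨ f-step (S≤1 a a∈S) 0≤h h≤2 ⟩
            f a + 5# * h     ≤⟨ +-monoˡ-≤ _ (proj₂ a∈S) ⟩
            q + 5# * h       ∎)

      fs≤q : f s ≤ q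
      fs≤q with O.total (f s) q
      ... | inj₁ p = p
      ... | inj₂ q≤fs =
        let d , 0≤d , q+d≈fs = split q≤fs
            d≤2 = O.trans (y≤x+y 0≤q) (O.trans (O.reflexive q+d≈fs) fs≤2)
            h , (0≤h , h≤2) , d≈ = sixth 0≤d d≤2
        in excess q+d≈fs d≈ (above q+d≈fs 0≤h h≤2 d≈)

    root : ∃ λ s → (0# ≤ s × s ≤ 1#) × f s ≈ q
    root =
      let s , ub , least = complete S (0# , 0∈S) (1# , S≤1)
          open Supremum s ub least
      in s , (0≤s , s≤1) , O.antisym fs≤q q≤fs

  f-injective : ∀ {a b} → 0# ≤ a → a ≤ b → f b ≤ f a → a ≈ b
  f-injective {a} {b} 0≤a a≤b fb≤fa with split a≤b
  ... | h , 0≤h , a+h≈b = O.antisym a≤b (begin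
    b       ≈⟨ a+h≈b ⟨
    a + h   ≤⟨ +-monoʳ-≤ a (O.trans h≤ (x+h≤x⇒h≤0 {f a} (begin
      f a + h * (1# + (a + a + h)) ≈⟨ f-expand a h ⟨
      f (a + h)                    ≈⟨ trans (*-congʳ a+h≈b) (*-congˡ (+-congˡ a+h≈b)) ⟩
      f b                          ≤⟨ fb≤fa ⟩
      f a                          ∎))) ⟩
    a + 0#  ≈⟨ +-identityʳ a ⟩
    a       ∎)
    where
    h≤ : h ≤ h * (1# + (a + a + h))
    h≤ = h≤h*[1+x] 0≤h (+-nonNeg (+-nonNeg 0≤a 0≤a) 0≤h)

  module Ratio (ε : Carrier) (0≤ε : 0# ≤ ε) (ε≤1 : ε ≤ 1#) where

    q : Carrier
    q = (1# - ε) ÷ (1# + ε)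

    1≤1+ε : 1# ≤ 1# + ε
    1≤1+ε = x≤x+y 0≤ε

    0≤q : 0# ≤ q
    0≤q = *-nonNegative (x≤y⇒0≤y-x ε≤1) (⁻¹-nonNeg 1≤1+ε)

    q≤1 : q ≤ 1#
    q≤1 = begin
      (1# - ε) * (1# + ε) ⁻¹  ≈⟨ *-comm _ _ ⟩
      (1# + ε) ⁻¹ * (1# - ε)  ≤⟨ *-monoʳ-≤ (⁻¹-nonNeg 1≤1+ε) 1-ε≤1+ε ⟩
      (1# + ε) ⁻¹ * (1# + ε)  ≈⟨ *-comm _ _ ⟩
      (1# + ε) * (1# + ε) ⁻¹  ≈⟨ *-inverseʳ _ (1≤x⇒x≉0 1≤1+ε) ⟩
      1#                      ∎
      where
      1-ε≤1+ε : 1# - ε ≤ 1# + ε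
      1-ε≤1+ε = begin
        1# - ε        ≤⟨ x≤x+y 0≤ε ⟩
        (1# - ε) + ε  ≈⟨ x-y+y≈x 1# ε ⟩
        1#            ≤⟨ 1≤1+ε ⟩
        1# + ε        ∎

module ConnectivityThreshold (ℝ : RealNumbers) where

  open RealNumbers ℝ
  open QuadraticRoot ℝ
  open CommutativeRing commutativeRing using (sym; trans)

  IsThreshold : Carrier → Carrier → Set
  IsThreshold ε α =
    (0# ≤ α × α ≤ 1#) × α * (1# + α) ≈ (1# - ε) ÷ (1# + ε)

  threshold-exists! : ∀ ε → 0# ≤ ε → ε < 1# → ∃! _≈_ (IsThreshold ε)
  threshold-exists! ε 0≤ε (ε≤1 , _) =
    let s , (0≤s , s≤1) , fs≈q = root
    in s , ((0≤s , s≤1) , fs≈q) , unique 0≤s fs≈q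
    where
    open Ratio ε 0≤ε ε≤1
    open Root q 0≤q q≤1
    unique : ∀ {s a} → 0# ≤ s → f s ≈ q → IsThreshold ε a → s ≈ a
    unique {s} {a} 0≤s fs≈q ((0≤a , _) , fa≈q) with O.total s a
    ... | inj₁ s≤a =
      f-injective 0≤s s≤a (O.reflexive (trans fa≈q (sym fs≈q)))
    ... | inj₂ a≤s =
      sym (f-injective 0≤a a≤s (O.reflexive (trans fs≈q (sym fa≈q))))

  -- α_ε
  threshold : ∀ ε → 0# ≤ ε → ε < 1# → Carrier
  threshold ε 0≤ε ε<1 = proj₁ (threshold-exists! ε 0≤ε ε<1)

-- The least m < b satisfying P, or b if there is none.
leastBelow : {P : ℕ → Set} → (∀ m → Dec (P m)) → ℕ → ℕ
leastBelow P? zero    = zero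
leastBelow P? (suc b) =
  if does (P? zero) then zero else suc (leastBelow (P? ∘ suc) b)

-- Excluded middle makes the predicates on real matrices decidable, which is
-- what allows N(α; A) and the cardinality of a support to be natural numbers.

module Sparsification (lem : ExcludedMiddle 0ℓ) (ℝ : RealNumbers) where

  open RealNumbers ℝ
  open Summation +-commutativeMonoid using (sum)
  open ConnectivityThreshold ℝ public using (IsThreshold; threshold-exists!; threshold)

  Matrix : ℕ → Set
  Matrix n = Fin n → Fin n → Carrier

  _⊖_ : ∀ {n} → Matrix n → Matrix n → Matrix n
  (B ⊖ A) k l = B k l - A k l

  infixr 7 _•_
  _•_ : ∀ {n} → Carrier → Matrix n → Matrix n
  (c • A) k l = c * A k l

  PSD : ∀ {n} → Matrix n → Set
  PSD {n} A =
    (∀ k l → A k l ≈ A l k) ×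
    (∀ (x : Vector Carrier n) → 0# ≤ sum λ k → sum λ l → x k * A k l * x l)

  infix 4 _⪯_
  _⪯_ : ∀ {n} → Matrix n → Matrix n → Set
  A ⪯ B = PSD (B ⊖ A)

  -- Σ_{j ∈ T} A j
  sumOver : ∀ {n r} → Subset r → (Fin r → Matrix n) → Matrix n
  sumOver T A k l = sum λ j → if does (j ∈? T) then A j k l else 0#

  module _ {n r : ℕ} (A : Fin r → Matrix n) where

    Connected : Carrier → ℕ → Set
    Connected α m = ∀ (T : Subset r) → m ℕ.≤ ∣ T ∣ →
      ∃ λ i → i ∈ T × α • A i ⪯ sumOver (T ∖ i) A

    -- N(α; A): the candidates are 0, …, r, with value r + 1 if all of them fail.
    connectivity : Carrier → ℕ
    connectivity α = leastBelow (λ m → lem {Connected α m}) (suc r)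

    -- N*_ε(A)
    connectivityThreshold : ∀ ε → 0# ≤ ε → ε < 1# → ℕ
    connectivityThreshold ε 0≤ε ε<1 = connectivity (threshold ε 0≤ε ε<1)

    -- A map T → ℝ is given by a map on all of Fin r of which only the values
    -- on T are ever used.
    supp : Subset r → (Fin r → Carrier) → Subset r
    supp T μ = tabulate λ i → does ((i ∈? T) ×-dec ¬? (lem {μ i ≈ 0#}))

    NontrivialSparsifier : Carrier → Subset r → (Fin r → Carrier) → Set
    NontrivialSparsifier ε T μ =
      (∀ i → i ∈ T → 0# ≤ μ i) ×
      ∣ supp T μ ∣ ℕ.< ∣ T ∣ ×
      (1# - ε) • sumOver T A ⪯ sumOver T (λ i → μ i • A i) ×
      sumOver T (λ i → μ i • A i) ⪯ (1# + ε) • sumOver T A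

    AdmitsSparsifier : Carrier → Subset r → Set
    AdmitsSparsifier ε T = ∃ (NontrivialSparsifier ε T)

{-# OPTIONS --safe #-}

-- Fix ε, let α = α_ε and c = (1 + ε)(1 + α), so that c α = 1 - ε.  Suppose μ is
-- a non-trivial ε-sparsifier of T; then μ vanishes at some i₀ ∈ T.
--   If c ≤ μ_i for some i ∈ T, then c A_i ⪯ Σ μ_j A_j ⪯ (1 + ε) Σ_T A_j, and
-- dividing by 1 + ε and subtracting A_i gives α A_i ⪯ Σ_{T∖i} A_j.
--   Otherwise c α Σ_T A_j ⪯ Σ μ_j A_j ⪯ c Σ_{T∖i₀} A_j, and dividing by c gives
-- α A_{i₀} ⪯ Σ_{T∖i₀} A_j.
-- So a set T that violates the connectivity condition for α_ε has no
-- non-trivial ε-sparsifier, and by minimality of N(α) there is one of size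
-- N(α) - 1.  For the limit, "connected for some α > 0" is itself a condition on
-- the finitely many subsets T, so a single δ > 0 serves all of them: the limit
-- is the connectivity parameter of that condition and N is constant on (0, δ).

module Submission where

open import Defs
open import Algebra.Bundles using (CommutativeRing; CommutativeSemiring)
open import Axiom.ExcludedMiddle using (ExcludedMiddle)
open import Data.Bool.Base using (true; false; if_then_else_)
open import Data.Fin.Base using (Fin; zero; suc)
open import Data.Fin.Properties using (punchInᵢ≢i)
open import Data.Fin.Subset using (Subset; ∣_∣; _∈_; _∉_; ⊥; inside; outside) renaming (_-_ to _∖_)
open import Data.Fin.Subset.Properties using (_∈?_; ∣p∣≤n; ∉⊥; p⊆q⇒∣p∣≤∣q∣; p─q⊆p; x∈p∧x≢y⇒x∈p-y)
open import Data.Nat.Base as ℕ using (ℕ; zero; suc)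
import Data.Nat.Properties as ℕ
open import Data.Product.Base using (∃; _×_; _,_; proj₁; proj₂)
open import Data.Sum.Base using (inj₁; inj₂)
open import Data.Vec.Base using ([]; _∷_; there; tabulate)
open import Data.Vec.Functional using (Vector; removeAt)
open import Data.Vec.Properties using (lookup⇒[]=; lookup∘tabulate)
open import Function.Base using (_∘_)
open import Function.Bundles using (mk⇔)
open import Level using (0ℓ)
open import Relation.Binary.PropositionalEquality.Core as ≡ using (_≡_; _≢_)
open import Relation.Nullary using (¬_; Dec; yes; no; does; contradiction)
open import Relation.Nullary.Decidable using (_×-dec_; ¬?; dec-true; dec-false; does-⇔; decidable-stable)
import Algebra.Properties.Semiring.Sum as SemiringSum
import Algebra.Solver.Ring.NaturalCoefficients.Default as SemiringSolver
import Relation.Binary.Reasoning.PartialOrder as PosetReasoning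

-- Bounded least-number search and finite subsets.

-- The search inspects only the Boolean outcomes of the tests, so equivalent predicates give the
-- same value.
leastBelow-cong : {P Q : ℕ → Set} (P? : ∀ m → Dec (P m)) (Q? : ∀ m → Dec (Q m)) →
                  (∀ m → does (P? m) ≡ does (Q? m)) →
                  ∀ b → leastBelow P? b ≡ leastBelow Q? b
leastBelow-cong P? Q? eq zero = ≡.refl
leastBelow-cong P? Q? eq (suc b)
  rewrite eq 0 | leastBelow-cong (P? ∘ suc) (Q? ∘ suc) (eq ∘ suc) b = ≡.refl

leastBelow-minimal : {P : ℕ → Set} (P? : ∀ m → Dec (P m)) →
                     ∀ b {m} → m ℕ.< leastBelow P? b → ¬ P m
leastBelow-minimal P? (suc b) m<l with P? 0
leastBelow-minimal P? (suc b) {zero}  m<l | no ¬p = ¬p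
leastBelow-minimal P? (suc b) {suc m} m<l | no ¬p =
  leastBelow-minimal (P? ∘ suc) b (ℕ.s<s⁻¹ m<l)

-- A value strictly below `b` is one at which the search stopped on a positive test. The value `b`
-- itself only reports failure.
leastBelow-satisfies : {P : ℕ → Set} (P? : ∀ m → Dec (P m)) →
                       ∀ b → leastBelow P? b ℕ.< b → P (leastBelow P? b)
leastBelow-satisfies P? (suc b) l<b with P? 0
... | yes p = p
... | no _  = leastBelow-satisfies (P? ∘ suc) b (ℕ.s<s⁻¹ l<b)

x∉p-x : ∀ {n} {x : Fin n} {p : Subset n} → x ∉ p ∖ x
x∉p-x {x = zero}  {outside ∷ p} ()
x∉p-x {x = zero}  {inside ∷ p}  ()
x∉p-x {x = suc x} {s ∷ p} (there x∈) = x∉p-x {x = x} {p} x∈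

x∈tabulate : ∀ {n} {P : Fin n → Set} (P? : ∀ x → Dec (P x)) →
             ∀ {x} → P x → x ∈ tabulate (does ∘ P?)
x∈tabulate P? {x} px =
  lookup⇒[]= x _ (≡.trans (lookup∘tabulate (does ∘ P?) x) (dec-true (P? x) px))

module Obstruction (lem : ExcludedMiddle 0ℓ) (ℝ : RealNumbers) where

  open RealNumbers ℝ
  open Sparsification lem ℝ
  open QuadraticRoot ℝ
  open CommutativeRing commutativeRing
    using (refl; sym; trans; +-cong; +-congˡ; +-congʳ; *-congˡ; *-congʳ; -‿cong;
           +-comm; *-comm; *-assoc; +-identityˡ;
           *-identityˡ; *-identityʳ; zeroˡ; zeroʳ)
  open SemiringSum (CommutativeSemiring.semiring commutativeSemiring)
    using (sum; sum-cong-≋; sum-replicate-zero; sum-remove; ∑-distrib-+; ∑-comm;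
           *-distribˡ-sum; *-distribʳ-sum)
  open PosetReasoning poset
  open SemiringSolver commutativeSemiring using (solve; con; _:+_; _:*_; _:=_)

  -- Order and cancellation in the real field.

  *-monoˡ-≤ : ∀ {z x y} → 0# ≤ z → x ≤ y → x * z ≤ y * z
  *-monoˡ-≤ {z} {x} {y} 0≤z x≤y = begin
    x * z ≈⟨ *-comm x z ⟩
    z * x ≤⟨ *-monoʳ-≤ 0≤z x≤y ⟩
    z * y ≈⟨ *-comm z y ⟩
    y * z ∎

  -- Multiply by `c ⁻¹`, which is nonnegative for `c` at least 1. The factors divided out later are
  -- 1 + ε and (1 + ε)(1 + α).
  *-cancelˡ-≤ : ∀ {c x y} → 1# ≤ c → c * x ≤ c * y → x ≤ y
  *-cancelˡ-≤ {c} {x} {y} 1≤c cx≤cy = begin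
    x              ≈⟨ c⁻¹cx≈x x ⟨
    c ⁻¹ * (c * x) ≤⟨ *-monoʳ-≤ (⁻¹-nonNeg 1≤c) cx≤cy ⟩
    c ⁻¹ * (c * y) ≈⟨ c⁻¹cx≈x y ⟩
    y              ∎
    where
    c⁻¹cx≈x : ∀ x → c ⁻¹ * (c * x) ≈ x
    c⁻¹cx≈x x = begin-equality
      c ⁻¹ * (c * x) ≈⟨ *-assoc _ c x ⟨
      c ⁻¹ * c * x   ≈⟨ *-congʳ (trans (*-comm _ c) (*-inverseʳ c (1≤x⇒x≉0 1≤c))) ⟩
      1# * x         ≈⟨ *-identityˡ x ⟩
      x              ∎

  x<x+η : ∀ {x η} → 0# < η → x < x + η
  x<x+η {x} {η} (0≤η , 0≉η) =
    x≤x+y 0≤η , λ x≈x+η → 0≉η (O.antisym 0≤η (x+h≤x⇒h≤0 (O.reflexive (sym x≈x+η))))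

  x-η<x : ∀ {x η} → 0# < η → x - η < x
  x-η<x {x} {η} 0<η =
    let x-η≤ , x-η≉ = x<x+η {x - η} 0<η
    in O.trans x-η≤ (O.reflexive (x-y+y≈x x η)) ,
       λ x-η≈x → x-η≉ (trans x-η≈x (sym (x-y+y≈x x η)))

  -- Sums over a subset of the indices.

  sum-mono : ∀ {n} {a b : Vector Carrier n} → (∀ i → a i ≤ b i) → sum a ≤ sum b
  sum-mono {zero}  a≤b = O.refl
  sum-mono {suc n} a≤b = +-mono-≤ (a≤b zero) (sum-mono (a≤b ∘ suc))

  -- Definitionally, sumOver T A k l = ∑∈ T (λ j → A j k l).
  ∑∈ : ∀ {r} → Subset r → (Fin r → Carrier) → Carrier
  ∑∈ T a = sum λ j → if does (j ∈? T) then a j else 0#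

  module _ {r : ℕ} where

    ∑∈-mono : ∀ (T : Subset r) {a b} → (∀ j → j ∈ T → a j ≤ b j) → ∑∈ T a ≤ ∑∈ T b
    ∑∈-mono T {a} {b} a≤b = sum-mono pointwise
      where
      pointwise : ∀ j → (if does (j ∈? T) then a j else 0#) ≤
                        (if does (j ∈? T) then b j else 0#)
      pointwise j with j ∈? T
      ... | yes j∈T = a≤b j j∈T
      ... | no  _   = O.refl

    ∑∈-cong : ∀ (T : Subset r) {a b} → (∀ j → a j ≈ b j) → ∑∈ T a ≈ ∑∈ T b
    ∑∈-cong T a≈b = O.antisym (∑∈-mono T λ j _ → O.reflexive (a≈b j))
                              (∑∈-mono T λ j _ → O.reflexive (sym (a≈b j)))

    *-distribˡ-∑∈ : ∀ c (T : Subset r) a → c * ∑∈ T a ≈ ∑∈ T (λ j → c * a j)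
    *-distribˡ-∑∈ c T a =
      trans (*-distribˡ-sum {r} c _) (sum-cong-≋ pointwise)
      where
      pointwise : ∀ j → c * (if does (j ∈? T) then a j else 0#) ≈
                        (if does (j ∈? T) then c * a j else 0#)
      pointwise j with does (j ∈? T)
      ... | true  = refl
      ... | false = zeroʳ c

    ∑∈-nonNeg : ∀ (T : Subset r) {a} → (∀ j → j ∈ T → 0# ≤ a j) → 0# ≤ ∑∈ T a
    ∑∈-nonNeg T {a} 0≤a = begin
      0#                    ≈⟨ zeroˡ _ ⟨
      0# * ∑∈ T a           ≈⟨ *-distribˡ-∑∈ 0# T a ⟩
      ∑∈ T (λ j → 0# * a j) ≤⟨ ∑∈-mono T (λ j j∈T → O.trans (O.reflexive (zeroˡ _)) (0≤a j j∈T)) ⟩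
      ∑∈ T a                ∎

  -- Both sums are split at `i`: away from `i` their summands agree, and at `i` the second one
  -- contributes 0.
  ∑∈-remove : ∀ {r} {T : Subset r} {i} a → i ∈ T → ∑∈ T a ≈ a i + ∑∈ (T ∖ i) a
  ∑∈-remove {suc r} {T} {i} a i∈T = begin-equality
    ∑∈ T a                                 ≈⟨ sum-remove {i = i} (term T) ⟩
    term T i + sum (removeAt (term T) i)   ≈⟨ +-cong term-in (sum-cong-≋ rest) ⟩
    a i + sum (removeAt (term T∖i) i)      ≈⟨ +-congˡ (+-identityˡ _) ⟨
    a i + (0# + sum (removeAt (term T∖i) i))
      ≈⟨ +-congˡ (+-congʳ (sym term-out)) ⟩
    a i + (term T∖i i + sum (removeAt (term T∖i) i))
      ≈⟨ +-congˡ (sum-remove {i = i} (term T∖i)) ⟨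
    a i + ∑∈ T∖i a                         ∎
    where
    T∖i : Subset (suc r)
    T∖i = T ∖ i
    term : Subset (suc r) → Fin (suc r) → Carrier
    term S j = if does (j ∈? S) then a j else 0#
    term-in : term T i ≈ a i
    term-in rewrite dec-true (i ∈? T) i∈T = refl
    term-out : term T∖i i ≈ 0#
    term-out rewrite dec-false (i ∈? T∖i) (x∉p-x {x = i} {T}) = refl
    same : ∀ {j} → j ≢ i → term T j ≈ term T∖i j
    same {j} j≢i
      rewrite does-⇔ (mk⇔ (λ j∈T → x∈p∧x≢y⇒x∈p-y j∈T j≢i) (p─q⊆p T _))
                     (j ∈? T) (j ∈? T∖i) = refl
    rest : ∀ j → removeAt (term T) i j ≈ removeAt (term T∖i) i j
    rest j = same (punchInᵢ≢i i j)

  -- Quadratic forms and the semidefinite order.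

  form : ∀ {n} → Matrix n → Vector Carrier n → Carrier
  form A x = sum λ k → sum λ l → x k * A k l * x l

  module _ {n : ℕ} (x : Vector Carrier n) where

    private
      term : Matrix n → Matrix n
      term A k l = x k * A k l * x l

    form-cong : {A B : Matrix n} → (∀ k l → A k l ≈ B k l) → form A x ≈ form B x
    form-cong A≈B = sum-cong-≋ λ k → sum-cong-≋ λ l → *-congʳ (*-congˡ (A≈B k l))

    form-+ : (A B : Matrix n) → form (λ k l → A k l + B k l) x ≈ form A x + form B x
    form-+ A B = begin-equality
      (sum λ k → sum λ l → x k * (A k l + B k l) * x l)
        ≈⟨ sum-cong-≋ (λ k → sum-cong-≋ λ l →
             solve 4 (λ x a b y → x :* (a :+ b) :* y := x :* a :* y :+ x :* b :* y)
               refl (x k) (A k l) (B k l) (x l)) ⟩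
      (sum λ k → sum λ l → term A k l + term B k l)
        ≈⟨ sum-cong-≋ (λ k → ∑-distrib-+ (term A k) (term B k)) ⟩
      (sum λ k → sum (term A k) + sum (term B k))
        ≈⟨ ∑-distrib-+ (λ k → sum (term A k)) (λ k → sum (term B k)) ⟩
      form A x + form B x ∎

    form-⊖ : (A B : Matrix n) → form (B ⊖ A) x + form A x ≈ form B x
    form-⊖ A B = trans (sym (form-+ (B ⊖ A) A)) (form-cong λ k l → x-y+y≈x (B k l) (A k l))

    form-• : ∀ c (A : Matrix n) → form (c • A) x ≈ c * form A x
    form-• c A = begin-equality
      (sum λ k → sum λ l → x k * (c * A k l) * x l)
        ≈⟨ sum-cong-≋ (λ k → sum-cong-≋ λ l →
             solve 4 (λ c x a y → x :* (c :* a) :* y := c :* (x :* a :* y))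
               refl c (x k) (A k l) (x l)) ⟩
      (sum λ k → sum λ l → c * term A k l)
        ≈⟨ sum-cong-≋ (λ k → *-distribˡ-sum c (term A k)) ⟨
      (sum λ k → c * sum (term A k))
        ≈⟨ *-distribˡ-sum c (λ k → sum (term A k)) ⟨
      c * form A x ∎

    -- After distributing the products, the summation over `j` is exchanged first with that over
    -- `l`, then with that over `k`.
    form-sum : ∀ {r} (A : Fin r → Matrix n) →
               form (λ k l → sum λ j → A j k l) x ≈ sum λ j → form (A j) x
    form-sum {r} A = begin-equality
      (sum λ k → sum λ l → x k * (sum λ j → A j k l) * x l)
        ≈⟨ sum-cong-≋ (λ k → sum-cong-≋ λ l →
             trans (*-congʳ (*-distribˡ-sum {r} (x k) _)) (*-distribʳ-sum {r} (x l) _)) ⟩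
      (sum λ k → sum λ l → sum λ j → x k * A j k l * x l)
        ≈⟨ sum-cong-≋ (λ k → ∑-comm (λ l j → x k * A j k l * x l)) ⟩
      (sum λ k → sum λ j → sum λ l → x k * A j k l * x l)
        ≈⟨ ∑-comm (λ k j → sum λ l → x k * A j k l * x l) ⟩
      (sum λ j → form (A j) x) ∎

    form-0 : form (λ _ _ → 0#) x ≈ 0#
    form-0 = trans (sum-cong-≋ λ k → trans
      (sum-cong-≋ λ l → trans (*-congʳ (zeroʳ (x k))) (zeroˡ (x l)))
      (sum-replicate-zero n)) (sum-replicate-zero n)

    form-sumOver : ∀ {r} (T : Subset r) (A : Fin r → Matrix n) →
                   form (sumOver T A) x ≈ ∑∈ T (λ j → form (A j) x)
    form-sumOver T A =
      trans (form-sum λ j k l → if does (j ∈? T) then A j k l else 0#)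
            (sum-cong-≋ pointwise)
      where
      pointwise : ∀ j → form (λ k l → if does (j ∈? T) then A j k l else 0#) x ≈
                        (if does (j ∈? T) then form (A j) x else 0#)
      pointwise j with does (j ∈? T)
      ... | true  = refl
      ... | false = form-0

  -- Together with its converse `form-≤⇒⪯`, this reduces every matrix inequality to scalar
  -- inequalities, one for each vector `x`.
  ⪯⇒form-≤ : ∀ {n} {A B : Matrix n} → A ⪯ B → ∀ x → form A x ≤ form B x
  ⪯⇒form-≤ {A = A} {B} (_ , 0≤B-A) x = begin
    form A x                    ≤⟨ y≤x+y (0≤B-A x) ⟩
    form (B ⊖ A) x + form A x   ≈⟨ form-⊖ x A B ⟩
    form B x                    ∎

  Symmetric : ∀ {n} → Matrix n → Set
  Symmetric A = ∀ k l → A k l ≈ A l k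

  -- `PSD` includes symmetry, which the values of the form do not determine; hence the two symmetry
  -- hypotheses.
  form-≤⇒⪯ : ∀ {n} {A B : Matrix n} → Symmetric A → Symmetric B →
             (∀ x → form A x ≤ form B x) → A ⪯ B
  form-≤⇒⪯ {A = A} {B} symA symB A≤B =
    (λ k l → +-cong (symB k l) (-‿cong (symA k l))) ,
    λ x → +-cancelʳ-≤ (form A x) (begin
      0# + form A x               ≈⟨ +-identityˡ _ ⟩
      form A x                    ≤⟨ A≤B x ⟩
      form B x                    ≈⟨ form-⊖ x A B ⟨
      form (B ⊖ A) x + form A x   ∎)

  -- Uniform choice over subsets, and largest violating sets.

  -- Induction on `r`: the subsets split by whether they contain the first element, and the smaller
  -- of the two values obtained serves both halves by downward closure.
  finite-choice : ∀ {r} (P : Subset r → Carrier → Set) →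
                  (∀ T {α β} → α ≤ β → P T β → P T α) →
                  (∀ T → ∃ λ α → 0# < α × P T α) →
                  ∃ λ δ → 0# < δ × ∀ T → P T δ
  finite-choice {zero} P P↓ choice =
    let δ , 0<δ , p = choice [] in δ , 0<δ , λ where [] → p
  finite-choice {suc r} P P↓ choice
    with finite-choice (P ∘ (outside ∷_)) (P↓ ∘ (outside ∷_)) (choice ∘ (outside ∷_))
       | finite-choice (P ∘ (inside ∷_)) (P↓ ∘ (inside ∷_)) (choice ∘ (inside ∷_))
  ... | δ , 0<δ , p | δ′ , 0<δ′ , p′ with O.total δ δ′
  ... | inj₁ δ≤δ′ = δ  , 0<δ  , λ where
    (outside ∷ T) → p T
    (inside  ∷ T) → P↓ _ δ≤δ′ (p′ T)
  ... | inj₂ δ′≤δ = δ′ , 0<δ′ , λ where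
    (outside ∷ T) → P↓ _ δ′≤δ (p T)
    (inside  ∷ T) → p′ T

  -- For C = ConnectedSet A α this is definitionally connectivity A α.
  module _ {r : ℕ} (C : Subset r → Set) where

    HoldsFrom : ℕ → Set
    HoldsFrom m = ∀ T → m ℕ.≤ ∣ T ∣ → C T

    parameter : ℕ
    parameter = leastBelow (λ m → lem {HoldsFrom m}) (suc r)

    -- The violation at `⊥` rules out the value 0. If the value is m + 1, then minimality gives a
    -- violator with at least m elements, while every set with more than m elements satisfies `C`;
    -- so the violator has exactly m.
    maximal-violator : ¬ C ⊥ → ∃ λ T → suc ∣ T ∣ ≡ parameter × ¬ C T
    maximal-violator ¬C⊥ with parameter in N≡
    ... | zero = contradiction
      (leastBelow-satisfies (λ m → lem {HoldsFrom m}) (suc r) (≡.subst (ℕ._< suc r) (≡.sym N≡) ℕ.z<s)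
        ⊥ (≡.subst (ℕ._≤ ∣ ⊥ {r} ∣) (≡.sym N≡) ℕ.z≤n))
      ¬C⊥
    ... | suc m = decidable-stable lem λ none →
      leastBelow-minimal (λ m → lem {HoldsFrom m}) (suc r)
        (≡.subst (m ℕ.<_) (≡.sym N≡) ℕ.≤-refl) λ T m≤∣T∣ → decidable-stable lem λ ¬CT →
      none (T , ≡.cong suc (ℕ.≤-antisym (ℕ.≮⇒≥ λ m<∣T∣ → ¬CT (large T m<∣T∣)) m≤∣T∣) , ¬CT)
      where
      large : ∀ T → m ℕ.< ∣ T ∣ → C T
      large T m<∣T∣ =
        -- The value may be r + 1, where the search has failed. The existence of `T` with more than
        -- m elements gives m + 1 ≤ r, so here the search has succeeded.
        leastBelow-satisfies (λ m → lem {HoldsFrom m}) (suc r)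
          (≡.subst (ℕ._< suc r) (≡.sym N≡) (ℕ.s≤s (ℕ.≤-trans m<∣T∣ (∣p∣≤n T))))
          T (≡.subst (ℕ._≤ ∣ T ∣) (≡.sym N≡) m<∣T∣)

  parameter-cong : ∀ {r} {C D : Subset r → Set} →
                   (∀ T → C T → D T) → (∀ T → D T → C T) → parameter C ≡ parameter D
  parameter-cong {r} {C} {D} C⇒D D⇒C =
    leastBelow-cong (λ m → lem {HoldsFrom C m}) (λ m → lem {HoldsFrom D m})
      (λ m → does-⇔ (mk⇔ (λ h T m≤ → C⇒D T (h T m≤)) (λ h T m≤ → D⇒C T (h T m≤))) lem lem)
      (suc r)

  -- Scalar inequalities at the threshold.

  threshold-spec : ∀ ε 0≤ε ε<1 → IsThreshold ε (threshold ε 0≤ε ε<1)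
  threshold-spec ε 0≤ε ε<1 = proj₁ (proj₂ (threshold-exists! ε 0≤ε ε<1))

  module _ {ε α : Carrier} (0≤ε : 0# ≤ ε) where

    private
      1≤1+ε : 1# ≤ 1# + ε
      1≤1+ε = x≤x+y 0≤ε

      c : Carrier
      c = (1# + ε) * (1# + α)

    c*α≈1-ε : IsThreshold ε α → c * α ≈ 1# - ε
    c*α≈1-ε (_ , α-root) = begin-equality
      (1# + ε) * (1# + α) * α
        ≈⟨ solve 2 (λ e a → e :* (con 1 :+ a) :* a := a :* (con 1 :+ a) :* e) refl (1# + ε) α ⟩
      α * (1# + α) * (1# + ε)                ≈⟨ *-congʳ α-root ⟩
      (1# - ε) * (1# + ε) ⁻¹ * (1# + ε)      ≈⟨ *-assoc _ _ _ ⟩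
      (1# - ε) * ((1# + ε) ⁻¹ * (1# + ε))    ≈⟨ *-congˡ (trans (*-comm _ _) (*-inverseʳ _ (1≤x⇒x≉0 1≤1+ε))) ⟩
      (1# - ε) * 1#                          ≈⟨ *-identityʳ _ ⟩
      1# - ε                                 ∎

    -- If α were 0, then 1 - ε = c α would vanish. Positivity places every threshold within the
    -- range of α that `EventuallyConnected` covers.
    threshold-positive : ε < 1# → IsThreshold ε α → 0# < α
    threshold-positive (_ , ε≉1) α-spec@((0≤α , _) , _) = 0≤α , λ 0≈α → ε≉1 (begin-equality
      ε              ≈⟨ +-identityˡ ε ⟨
      0# + ε         ≈⟨ +-congʳ (trans (sym (zeroʳ c)) (*-congˡ 0≈α)) ⟩
      c * α + ε      ≈⟨ +-congʳ (c*α≈1-ε α-spec) ⟩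
      (1# - ε) + ε   ≈⟨ x-y+y≈x 1# ε ⟩
      1#             ∎)

    -- Here `a` stands for the form of one matrix and `R` for that of the others. Dividing by 1 + ε
    -- leaves (1 + α) a ≤ a + R.
    α*a≤R-heavy : ∀ {a R} → c * a ≤ (1# + ε) * (a + R) → α * a ≤ R
    α*a≤R-heavy {a} {R} ca≤ = +-cancelʳ-≤ a (begin
      α * a + a     ≈⟨ solve 2 (λ α a → α :* a :+ a := (con 1 :+ α) :* a) refl α a ⟩
      (1# + α) * a  ≤⟨ *-cancelˡ-≤ 1≤1+ε (O.trans (O.reflexive (sym (*-assoc _ _ a))) ca≤) ⟩
      a + R         ≈⟨ +-comm a R ⟩
      R + a         ∎)

    -- Since 1 - ε = c α, dividing by `c` gives α (a + R) ≤ R, and α a is at most the left side.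
    α*a≤R-light : ∀ {a R} → 0# ≤ R → IsThreshold ε α →
                  (1# - ε) * (a + R) ≤ c * R → α * a ≤ R
    α*a≤R-light {a} {R} 0≤R α-spec@((0≤α , _) , _) ≤cR = begin
      α * a        ≤⟨ *-monoʳ-≤ 0≤α (x≤x+y 0≤R) ⟩
      α * (a + R)  ≤⟨ *-cancelˡ-≤ 1≤c (begin
        c * (α * (a + R))  ≈⟨ *-assoc c α _ ⟨
        c * α * (a + R)    ≈⟨ *-congʳ (c*α≈1-ε α-spec) ⟩
        (1# - ε) * (a + R) ≤⟨ ≤cR ⟩
        c * R              ∎) ⟩
      R            ∎
      where
      1≤c : 1# ≤ c
      1≤c = begin
        1#                   ≤⟨ 1≤1+ε ⟩
        1# + ε               ≈⟨ *-identityʳ _ ⟨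
        (1# + ε) * 1#        ≤⟨ *-monoʳ-≤ (O.trans 0≤1 1≤1+ε) (x≤x+y 0≤α) ⟩
        c                    ∎

  -- Sparsifiers force connectedness; behaviour for small α.

  module _ {n r : ℕ} (A : Fin r → Matrix n) where

    ConnectedSet : Carrier → Subset r → Set
    ConnectedSet α T = ∃ λ i → i ∈ T × α • A i ⪯ sumOver (T ∖ i) A

    ¬ConnectedSet-⊥ : ∀ {α} → ¬ ConnectedSet α ⊥
    ¬ConnectedSet-⊥ (_ , i∈⊥ , _) = ∉⊥ i∈⊥

    EventuallyConnected : Subset r → Set
    EventuallyConnected T = ∃ λ α → 0# < α × ConnectedSet α T

    -- If no weight on `T` vanished, `T` would be contained in the support and could not be larger
    -- than it.
    nontrivial⇒zero : ∀ (T : Subset r) μ → ∣ supp A T μ ∣ ℕ.< ∣ T ∣ → ∃ λ i → i ∈ T × μ i ≈ 0#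
    nontrivial⇒zero T μ ∣supp∣<∣T∣ = decidable-stable lem λ none →
      ℕ.<⇒≱ ∣supp∣<∣T∣ (p⊆q⇒∣p∣≤∣q∣ λ i∈T →
        x∈tabulate (λ i → (i ∈? T) ×-dec ¬? (lem {μ i ≈ 0#}))
          (i∈T , λ μᵢ≈0 → none (_ , i∈T , μᵢ≈0)))

    module _ (psd : ∀ i → PSD (A i)) where

      sumOver-symmetric : ∀ T → Symmetric (sumOver T A)
      sumOver-symmetric T k l = ∑∈-cong T λ j → proj₁ (psd j) k l

      form-nonNeg : ∀ x j → 0# ≤ form (A j) x
      form-nonNeg x j = proj₂ (psd j) x

      ⪯-sumOver : ∀ {α i T} →
        (∀ x → α * form (A i) x ≤ ∑∈ T (λ j → form (A j) x)) → α • A i ⪯ sumOver T A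
      ⪯-sumOver {α} {i} {T} α≤ =
        form-≤⇒⪯ (λ k l → *-congˡ (proj₁ (psd i) k l)) (sumOver-symmetric T) λ x → begin
          form (α • A i) x           ≈⟨ form-• x α (A i) ⟩
          α * form (A i) x           ≤⟨ α≤ x ⟩
          ∑∈ T (λ j → form (A j) x)  ≈⟨ form-sumOver x T A ⟨
          form (sumOver T A) x       ∎

      -- The same index `i` works, because the form of `A i` is nonnegative.
      ConnectedSet-antitone : ∀ {α β T} → α ≤ β → ConnectedSet β T → ConnectedSet α T
      ConnectedSet-antitone {α} {β} {T} α≤β (i , i∈T , β⪯) = i , i∈T , ⪯-sumOver λ x → begin
        α * form (A i) x                 ≤⟨ *-monoˡ-≤ (form-nonNeg x i) α≤β ⟩
        β * form (A i) x                 ≈⟨ form-• x β (A i) ⟨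
        form (β • A i) x                 ≤⟨ ⪯⇒form-≤ β⪯ x ⟩
        form (sumOver (T ∖ i) A) x       ≈⟨ form-sumOver x (T ∖ i) A ⟩
        ∑∈ (T ∖ i) (λ j → form (A j) x)  ∎

      module _ {ε α : Carrier} {T : Subset r} (0≤ε : 0# ≤ ε) where

        sparsifier⇒connected : IsThreshold ε α → AdmitsSparsifier A ε T → ConnectedSet α T
        sparsifier⇒connected α-spec (μ , 0≤μ , ∣supp∣<∣T∣ , lower , upper) =
          -- The case distinction concerns the weights alone and precedes the choice of `x`, so a
          -- single index serves all vectors.
          connected (lem {∃ λ i → i ∈ T × c ≤ μ i})
          where
          c : Carrier
          c = (1# + ε) * (1# + α)

          a : Vector Carrier n → Fin r → Carrier
          a x j = form (A j) x

          weighted : ∀ x → form (sumOver T (λ j → μ j • A j)) x ≈ ∑∈ T (λ j → μ j * a x j)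
          weighted x = trans (form-sumOver x T _) (∑∈-cong T λ j → form-• x (μ j) (A j))

          scaled : ∀ b x → form (b • sumOver T A) x ≈ b * ∑∈ T (a x)
          scaled b x = trans (form-• x b _) (*-congˡ (form-sumOver x T A))

          heavy : ∀ {i} → i ∈ T → c ≤ μ i → ∀ x → α * a x i ≤ ∑∈ (T ∖ i) (a x)
          heavy {i} i∈T c≤μᵢ x = α*a≤R-heavy 0≤ε (begin
            c * a x i
              ≤⟨ *-monoˡ-≤ (form-nonNeg x i) c≤μᵢ ⟩
            μ i * a x i
              -- The remaining weighted forms are nonnegative and can be added.
              ≤⟨ x≤x+y (∑∈-nonNeg (T ∖ i) λ j j∈ →
                   *-nonNegative (0≤μ j (p─q⊆p T _ j∈)) (form-nonNeg x j)) ⟩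
            μ i * a x i + ∑∈ (T ∖ i) (λ j → μ j * a x j)
              ≈⟨ ∑∈-remove _ i∈T ⟨
            ∑∈ T (λ j → μ j * a x j)
              ≈⟨ weighted x ⟨
            form (sumOver T (λ j → μ j • A j)) x
              ≤⟨ ⪯⇒form-≤ upper x ⟩
            form ((1# + ε) • sumOver T A) x
              ≈⟨ scaled (1# + ε) x ⟩
            (1# + ε) * ∑∈ T (a x)
              ≈⟨ *-congˡ (∑∈-remove _ i∈T) ⟩
            (1# + ε) * (a x i + ∑∈ (T ∖ i) (a x)) ∎)

          light : (∀ j → j ∈ T → μ j ≤ c) → ∀ {i} → i ∈ T → μ i ≈ 0# →
                  ∀ x → α * a x i ≤ ∑∈ (T ∖ i) (a x)
          light μ≤c {i} i∈T μᵢ≈0 x = α*a≤R-light 0≤ε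
            (∑∈-nonNeg (T ∖ i) λ j _ → form-nonNeg x j) α-spec (begin
            (1# - ε) * (a x i + ∑∈ (T ∖ i) (a x))
              ≈⟨ *-congˡ (∑∈-remove _ i∈T) ⟨
            (1# - ε) * ∑∈ T (a x)
              ≈⟨ scaled (1# - ε) x ⟨
            form ((1# - ε) • sumOver T A) x
              ≤⟨ ⪯⇒form-≤ lower x ⟩
            form (sumOver T (λ j → μ j • A j)) x
              ≈⟨ weighted x ⟩
            ∑∈ T (λ j → μ j * a x j)
              ≈⟨ ∑∈-remove _ i∈T ⟩
            -- The zero weight removes the term at `i`, so only the other indices have to be bounded
            -- by `c`.
            μ i * a x i + ∑∈ (T ∖ i) (λ j → μ j * a x j)
              ≈⟨ +-congʳ (trans (*-congʳ μᵢ≈0) (zeroˡ _)) ⟩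
            0# + ∑∈ (T ∖ i) (λ j → μ j * a x j)
              ≈⟨ +-identityˡ _ ⟩
            ∑∈ (T ∖ i) (λ j → μ j * a x j)
              ≤⟨ ∑∈-mono (T ∖ i) (λ j j∈ →
                   *-monoˡ-≤ (form-nonNeg x j) (μ≤c j (p─q⊆p T _ j∈))) ⟩
            ∑∈ (T ∖ i) (λ j → c * a x j)
              ≈⟨ *-distribˡ-∑∈ c (T ∖ i) (a x) ⟨
            c * ∑∈ (T ∖ i) (a x) ∎)

          connected : Dec (∃ λ i → i ∈ T × c ≤ μ i) → ConnectedSet α T
          connected (yes (i , i∈T , c≤μᵢ)) = i , i∈T , ⪯-sumOver (heavy i∈T c≤μᵢ)
          connected (no none) =
            let i , i∈T , μᵢ≈0 = nontrivial⇒zero T μ ∣supp∣<∣T∣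
            in i , i∈T , ⪯-sumOver (light μ≤c i∈T μᵢ≈0)
            where
            μ≤c : ∀ j → j ∈ T → μ j ≤ c
            μ≤c j j∈T with O.total (μ j) c
            ... | inj₁ μⱼ≤c = μⱼ≤c
            ... | inj₂ c≤μⱼ = contradiction (j , j∈T , c≤μⱼ) none

      eventual-threshold : ∃ λ δ → 0# < δ ×
        (∀ α → 0# < α → α < δ → connectivity A α ≡ parameter EventuallyConnected)
      eventual-threshold =
        let δ , 0<δ , uniform = finite-choice
              -- As an implication, the property has a positive witness for every `T`, even for
              -- those connected at no positive α.
              (λ T α → EventuallyConnected T → ConnectedSet α T)
              (λ T α≤β connected e → ConnectedSet-antitone α≤β (connected e))
              choice
        in δ , 0<δ , λ α 0<α (α≤δ , _) → parameter-cong
             (λ T connected → α , 0<α , connected)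
             (λ T e → ConnectedSet-antitone α≤δ (uniform T e))
        where
        choice : ∀ T → ∃ λ α → 0# < α × (EventuallyConnected T → ConnectedSet α T)
        choice T with lem {EventuallyConnected T}
        ... | yes (α , 0<α , connected) = α , 0<α , λ _ → connected
        -- The implication is vacuous here, and 1 is an arbitrary positive value.
        ... | no ¬e = 1# , (0≤1 , 0≉1) , λ e → contradiction e ¬e

theorem3p4 : (lem : ExcludedMiddle 0ℓ) (ℝ : RealNumbers) →
    let open RealNumbers ℝ
        open Sparsification lem ℝ in
    (n r : ℕ) (A : Fin r → Matrix n) → (∀ i → PSD (A i)) →
    (∀ ε (0≤ε : 0# ≤ ε) (ε<1 : ε < 1#) →
      ∃ λ (T : Subset r) →
        suc ∣ T ∣ ≡ connectivityThreshold A ε 0≤ε ε<1 ×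
        ¬ AdmitsSparsifier A ε T)
    ×
    (∃ λ (L : ℕ) →
      RightLimitAt0 (λ α → fromℕ (connectivity A α)) (fromℕ L) ×
      (∃ λ (T : Subset r) →
        suc ∣ T ∣ ≡ L ×
        (∀ ε → 0# ≤ ε → ε < 1# → ¬ AdmitsSparsifier A ε T)))
theorem3p4 lem ℝ n r A psd =
  (λ ε 0≤ε ε<1 →
    let T , size , ¬connected = maximal-violator _ (¬ConnectedSet-⊥ A)
    in T , size ,
       ¬connected ∘ sparsifier⇒connected A psd 0≤ε (threshold-spec ε 0≤ε ε<1)) ,
  parameter (EventuallyConnected A) ,
  -- The same δ serves every η: on (0, δ) the parameter equals its limit.
  (λ η 0<η →
    let δ , 0<δ , constant = eventual-threshold A psd
    in δ , 0<δ , λ α 0<α α<δ →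
       ≡.subst (λ m → fromℕ (parameter (EventuallyConnected A)) - η < fromℕ m ×
                      fromℕ m < fromℕ (parameter (EventuallyConnected A)) + η)
               (≡.sym (constant α 0<α α<δ))
               (x-η<x 0<η , x<x+η 0<η)) ,
  -- This `T` is connected at no positive α, hence at no threshold α_ε, so one set serves all ε.
  (let T , size , ¬connected = maximal-violator (EventuallyConnected A)
         λ (_ , _ , connected) → ¬ConnectedSet-⊥ A connected
   in T , size , λ ε 0≤ε ε<1 sparsifier →
      ¬connected (threshold ε 0≤ε ε<1 ,
        threshold-positive 0≤ε ε<1 (threshold-spec ε 0≤ε ε<1) ,
        sparsifier⇒connected A psd 0≤ε (threshold-spec ε 0≤ε ε<1) sparsifier))
  where
  open RealNumbers ℝ
  open Sparsification lem ℝ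
  open Obstruction lem ℝ
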